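{- For every integer $n\geq 3$, writing $f_q(n)$ for the total number of occurrences of the pattern $q$ in all permutations of $S_n(132,321)$, we have $$f_{213}(n)=f_{231}(n)=f_{312}(n)=\binom{n+2}{5},$$ $$f_{123}(n)=\frac{n(7n^4-40n^3+85n^2-80n+28)}{120}.$$
   Context: $S_n$ is the set of permutations of $\{1,\dots,n\}$ written in one-line notation $\sigma=\sigma_1\sigma_2\cdots\sigma_n$. For $q\in S_k$, an occurrence of the pattern $q$ in $\sigma\in S_n$ is a choice of indices $i_1<i_2<\cdots<i_k$ in $\{1,\dots,n\}$ such that for all $1\le j,l\le k$, $q_j<q_l$ if and only if $\sigma_{i_j}<\sigma_{i_l}$. Let $f_q(\sigma)$ be the number of occurrences of $q$ in $\sigma$; $\sigma$ avoids $q$ if $f_q(\sigma)=0$. $S_n(132,321)$ is the set of permutations in $S_n$ avoiding both $132$ and $321$, and $f_q(n)=\sum_{\sigma\in S_n(132,321)}f_q(\sigma)$. -}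

module Defs where

open import Data.Fin.Base using (Fin; _<_)
open import Data.Fin.Patterns using (0F; 1F; 2F)
open import Data.Fin.Properties using (_≟_; _<?_; all?)
open import Data.List.Base using (List; [_]; allFin; cartesianProductWith; filter; length; map)
open import Data.Nat.Base using (ℕ; zero; suc)
open import Data.Nat.ListAction using (sum)
import Data.Nat.Properties as ℕ
open import Data.Product.Base using (_×_; _,_)
open import Data.Vec.Base using (Vec; []; _∷_; lookup)
open import Data.Vec.Relation.Unary.AllPairs using (AllPairs; allPairs?)
open import Data.Vec.Relation.Unary.Unique.Propositional using (Unique)
open import Function.Bundles using (_⇔_; mk⇔; module Equivalence)
open import Relation.Binary.PropositionalEquality using (_≡_)
open import Relation.Nullary.Decidable using (Dec; map′; _×-dec_; _→-dec_; ¬?)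
open import Relation.Unary using (Decidable)

private
  variable
    k n : ℕ

infix 2 _⇔-dec_

_⇔-dec_ : {A B : Set} → Dec A → Dec B → Dec (A ⇔ B)
a? ⇔-dec b? = map′ (λ (f , g) → mk⇔ f g)
                   (λ e → Equivalence.to e , Equivalence.from e)
                   ((a? →-dec b?) ×-dec (b? →-dec a?))

-- All words of length k over the alphabet Fin n, each listed exactly once.
words : (n k : ℕ) → List (Vec (Fin n) k)
words n zero    = [ [] ]
words n (suc k) = cartesianProductWith _∷_ (allFin n) (words n k)

-- Permutations of n letters in one-line notation are the words of length n
-- over an n-letter alphabet without repeated letters.  Letters and positions
-- are numbered from 0 rather than from 1; this shift preserves order.
unique? : Decidable (Unique {A = Fin n} {k})
unique? = allPairs? (λ x y → ¬? (x ≟ y))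

S : (n : ℕ) → List (Vec (Fin n) n)
S n = filter unique? (words n n)

-- The vector is holds the chosen positions i₁ , … , i_k.
Occurrence : Vec (Fin k) k → Vec (Fin n) n → Vec (Fin n) k → Set
Occurrence q σ is =
  AllPairs _<_ is ×
  (∀ j l → (lookup q j < lookup q l) ⇔ (lookup σ (lookup is j) < lookup σ (lookup is l)))

occurrence? : (q : Vec (Fin k) k) (σ : Vec (Fin n) n) → Decidable (Occurrence q σ)
occurrence? q σ is =
  allPairs? _<?_ is ×-dec
  all? (λ j → all? (λ l →
    (lookup q j <? lookup q l) ⇔-dec (lookup σ (lookup is j) <? lookup σ (lookup is l))))

occurrences : Vec (Fin k) k → Vec (Fin n) n → ℕ
occurrences {k} {n} q σ = length (filter (occurrence? q σ) (words n k))

Avoids : Vec (Fin k) k → Vec (Fin n) n → Set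
Avoids q σ = occurrences q σ ≡ 0

avoids? : (q : Vec (Fin k) k) → Decidable (Avoids {n = n} q)
avoids? q σ = occurrences q σ ℕ.≟ 0

p123 p132 p213 p231 p312 p321 : Vec (Fin 3) 3
p123 = 0F ∷ 1F ∷ 2F ∷ []
p132 = 0F ∷ 2F ∷ 1F ∷ []
p213 = 1F ∷ 0F ∷ 2F ∷ []
p231 = 1F ∷ 2F ∷ 0F ∷ []
p312 = 2F ∷ 0F ∷ 1F ∷ []
p321 = 2F ∷ 1F ∷ 0F ∷ []

S[132,321] : (n : ℕ) → List (Vec (Fin n) n)
S[132,321] n = filter (λ σ → avoids? p132 σ ×-dec avoids? p321 σ) (S n)

total : Vec (Fin k) k → ℕ → ℕ
total q n = sum (map (occurrences q) (S[132,321] n))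

{-# OPTIONS --safe #-}
module Submission where

-- A permutation avoiding 132 and 321 arises from the identity by exchanging two
-- adjacent blocks of letters, which then occupy the positions [0, c) and [c, e];
-- its inversions i < j are exactly the pairs with i < c ≤ j ≤ e, and a
-- permutation is determined by its inversions.  Hence the occurrences of the three patterns are the chains
--   231: i < j < c ≤ l ≤ e,   213: i < c ≤ j ≤ e < l,   312: i < c ≤ j < l ≤ e
-- in {0, …, n−1}.  Making a weak inequality strict costs one more letter, so each
-- kind is counted by the 5-subsets of an (n+2)-set.  Finally every increasing
-- triple of positions of such a permutation is an occurrence of 123, 213, 231
-- or 312, and there are 1 + C(n,2) permutations, which gives the count for 123.

open import Defs
open import Data.Bool.Base using (Bool; true; false)
open import Data.Empty using (⊥; ⊥-elim)
open import Data.Fin.Base as Fin using (Fin; zero; suc; toℕ; fromℕ<; punchOut)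
open import Data.Fin.Patterns using (0F; 1F; 2F)
open import Data.Fin.Properties as Fin using (toℕ<n; toℕ-fromℕ<; toℕ-injective)
open import Data.Integer.Base using (ℤ; +_; _+_; _-_; _*_; _^_)
import Data.Integer.Properties as ℤ
import Data.Integer.Tactic.RingSolver as IntSolver
open import Data.List.Base as List using (List; []; _∷_; _++_; length; filter; map; allFin; cartesianProduct)
import Data.List.Membership.Propositional.Properties as ∈
open import Data.List.Membership.Propositional using (_∈_)
open import Data.List.Membership.Propositional.Properties.WithK using (unique∧set⇒bag)
open import Data.List.Properties using (length-map; length-++; filter-++; filter-none)
open import Data.List.Relation.Binary.BagAndSetEquality using (∼bag⇒↭)
open import Data.List.Relation.Binary.Permutation.Propositional.Properties using (↭-length)
open import Data.List.Relation.Unary.All as All using (All)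
import Data.List.Relation.Unary.All.Properties as All
open import Data.List.Relation.Unary.AllPairs using ([]; _∷_)
open import Data.List.Relation.Unary.Any using (here; there)
import Data.List.Relation.Unary.Unique.Propositional as List
import Data.List.Relation.Unary.Unique.Propositional.Properties as Unique
open import Data.Nat.Base as ℕ using (ℕ; zero; suc; _≥_; z≤n; s≤s; _!)
open import Data.Nat.Combinatorics using (_C_; nC1≡n; k>n⇒nCk≡0; nCk+nC[k+1]≡[n+1]C[k+1])
open import Data.Nat.ListAction using (sum)
import Data.Nat.Properties as ℕ
import Data.Nat.Tactic.RingSolver as NatSolver
open import Data.Product.Base using (_×_; _,_; proj₁; proj₂; ∃; ∃₂; uncurry)
open import Data.Rational.Base using (_/_)
open import Data.Rational.Properties using (fromℚᵘ-cong)
open import Data.Rational.Unnormalised.Base using (mkℚᵘ; *≡*)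
open import Data.Sum.Base using (_⊎_; inj₁; inj₂)
open import Data.Unit.Base using (⊤; tt)
open import Data.Vec.Base as Vec using (Vec; []; _∷_; lookup; tabulate)
import Data.Vec.Properties as Vec
import Data.Vec.Relation.Unary.All as VecAll
open import Data.Vec.Relation.Unary.AllPairs as VecPairs using (AllPairs; []; _∷_)
import Data.Vec.Relation.Unary.Unique.Propositional as Vec
import Data.Vec.Relation.Unary.Unique.Propositional.Properties as VecUnique
open import Function.Base using (_∘_; id)
open import Function.Bundles using (_⇔_; mk⇔; module Equivalence)
open import Relation.Binary.Definitions using (tri<; tri≈; tri>)
open import Relation.Binary.PropositionalEquality
  using (_≡_; _≢_; refl; sym; trans; cong; cong₂; subst; subst₂; module ≡-Reasoning)
open import Relation.Nullary.Decidable using (yes; no; _⊎-dec_)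
open import Relation.Nullary.Negation using (¬_; contradiction)
open import Relation.Unary using (Decidable)

private
  variable
    A B : Set
    k n : ℕ

-- Counting with duplicate-free lists

map⁺-∈ : {f : A → B} {xs : List A} →
         (∀ {x y} → x ∈ xs → y ∈ xs → f x ≡ f y → x ≡ y) →
         List.Unique xs → List.Unique (map f xs)
map⁺-∈ inj []          = []
map⁺-∈ inj (x∉ ∷ xs!) =
  All.map⁺ (All.tabulate λ y∈ eq → All.lookup x∉ y∈ (inj (here refl) (there y∈) eq)) ∷
  map⁺-∈ (λ x∈ y∈ → inj (there x∈) (there y∈)) xs!

-- Without duplicates, equal membership already means equal multiplicity, so the lists are
-- permutations of each other.
length-set : {xs ys : List A} → List.Unique xs → List.Unique ys →
             (∀ {x} → x ∈ xs → x ∈ ys) → (∀ {x} → x ∈ ys → x ∈ xs) →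
             length xs ≡ length ys
length-set xs! ys! to from = ↭-length (∼bag⇒↭ (unique∧set⇒bag xs! ys! (mk⇔ to from)))

-- Injectivity is asked on members of `ys` only, because `swap` is not injective on all pairs: every
-- pair with c = 0 or c > e gives the identity.
length-bijection : {xs : List A} {ys : List B} (g : B → A) →
                   List.Unique xs → List.Unique ys →
                   (∀ {y y′} → y ∈ ys → y′ ∈ ys → g y ≡ g y′ → y ≡ y′) →
                   (∀ {y} → y ∈ ys → g y ∈ xs) →
                   (∀ {x} → x ∈ xs → ∃ λ y → y ∈ ys × x ≡ g y) →
                   length xs ≡ length ys
length-bijection {xs = xs} {ys} g xs! ys! inj into onto =
  trans (length-set xs! (map⁺-∈ inj ys!) to from) (length-map g ys)
  where
  to : ∀ {x} → x ∈ xs → x ∈ map g ys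
  to x∈ with y , y∈ , refl ← onto x∈ = ∈.∈-map⁺ g y∈
  from : ∀ {x} → x ∈ map g ys → x ∈ xs
  from x∈ with y , y∈ , refl ← ∈.∈-map⁻ g x∈ = into y∈

length-filter-⊎ : {P Q R : A → Set} (P? : Decidable P) (Q? : Decidable Q) (R? : Decidable R) →
                  (∀ {x} → P x → Q x ⊎ R x) → (∀ {x} → Q x ⊎ R x → P x) →
                  (∀ {x} → Q x → R x → ⊥) → ∀ xs →
                  length (filter P? xs) ≡ length (filter Q? xs) ℕ.+ length (filter R? xs)
length-filter-⊎ P? Q? R? to from disjoint [] = refl
length-filter-⊎ P? Q? R? to from disjoint (x ∷ xs)
  with P? x | Q? x | R? x | length-filter-⊎ P? Q? R? to from disjoint xs
... | yes p | yes q | yes r | ih = ⊥-elim (disjoint q r)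
... | yes p | yes q | no ¬r | ih = cong suc ih
... | yes p | no ¬q | yes r | ih = trans (cong suc ih) (sym (ℕ.+-suc _ _))
... | yes p | no ¬q | no ¬r | ih with to p
...   | inj₁ q = contradiction q ¬q
...   | inj₂ r = contradiction r ¬r
length-filter-⊎ P? Q? R? to from disjoint (x ∷ xs) | no ¬p | yes q | _     | ih = contradiction (from (inj₁ q)) ¬p
length-filter-⊎ P? Q? R? to from disjoint (x ∷ xs) | no ¬p | no ¬q | yes r | ih = contradiction (from (inj₂ r)) ¬p
length-filter-⊎ P? Q? R? to from disjoint (x ∷ xs) | no ¬p | no ¬q | no ¬r | ih = ih

length-filter-map : {P : B → Set} (P? : Decidable P) (f : A → B) (xs : List A) →
                    length (filter P? (map f xs)) ≡ length (filter (P? ∘ f) xs)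
length-filter-map P? f [] = refl
length-filter-map P? f (x ∷ xs) with P? (f x)
... | yes _ = cong suc (length-filter-map P? f xs)
... | no  _ = length-filter-map P? f xs

length-filter-cartesianProduct :
  {P : A × B → Set} (P? : Decidable P) (xs : List A) (ys : List B) →
  length (filter P? (cartesianProduct xs ys)) ≡
  sum (map (λ x → length (filter (λ y → P? (x , y)) ys)) xs)
length-filter-cartesianProduct P? []       ys = refl
length-filter-cartesianProduct P? (x ∷ xs) ys = begin
  length (filter P? (map (x ,_) ys ++ cartesianProduct xs ys))
    ≡⟨ cong length (filter-++ P? (map (x ,_) ys) _) ⟩
  length (filter P? (map (x ,_) ys) ++ filter P? (cartesianProduct xs ys))
    ≡⟨ length-++ (filter P? (map (x ,_) ys)) ⟩
  length (filter P? (map (x ,_) ys)) ℕ.+ length (filter P? (cartesianProduct xs ys))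
    ≡⟨ cong₂ ℕ._+_ (length-filter-map P? (x ,_) ys) (length-filter-cartesianProduct P? xs ys) ⟩
  _ ∎
  where open ≡-Reasoning

sum-map-+ : (f g : A → ℕ) (xs : List A) →
            sum (map (λ x → f x ℕ.+ g x) xs) ≡ sum (map f xs) ℕ.+ sum (map g xs)
sum-map-+ f g []       = refl
sum-map-+ f g (x ∷ xs) = begin
  f x ℕ.+ g x ℕ.+ sum (map (λ x → f x ℕ.+ g x) xs)          ≡⟨ cong (f x ℕ.+ g x ℕ.+_) (sum-map-+ f g xs) ⟩
  f x ℕ.+ g x ℕ.+ (sum (map f xs) ℕ.+ sum (map g xs))       ≡⟨ ℕ-+-interchange (f x) (g x) _ _ ⟩
  f x ℕ.+ sum (map f xs) ℕ.+ (g x ℕ.+ sum (map g xs))       ∎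
  where
  open ≡-Reasoning
  open import Algebra.Properties.CommutativeSemigroup ℕ.+-commutativeSemigroup
    using () renaming (interchange to ℕ-+-interchange)

sum-map-const : (f : A → ℕ) (m : ℕ) (xs : List A) → (∀ {x} → x ∈ xs → f x ≡ m) →
                sum (map f xs) ≡ length xs ℕ.* m
sum-map-const f m []       eq = refl
sum-map-const f m (x ∷ xs) eq = cong₂ ℕ._+_ (eq (here refl)) (sum-map-const f m xs (eq ∘ there))

-- Chains of strict and weak inequalities

Link : Bool → Fin n → Fin n → Set
Link true  = Fin._<_
Link false = Fin._≤_

Chain : Vec Bool k → Vec (Fin n) (suc k) → Set
Chain []       (x ∷ [])     = ⊤
Chain (b ∷ bs) (x ∷ y ∷ ys) = Link b x y × Chain bs (y ∷ ys)

weak : Vec Bool k → ℕ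
weak []           = 0
weak (true  ∷ bs) = weak bs
weak (false ∷ bs) = suc (weak bs)

-- The split is by whether the first entry is `zero`. After a strict link the tail misses `zero` and
-- is a shifted chain over `n` letters; after a weak link the tail is any chain over all `suc n`
-- letters.
chains : Vec Bool k → (n : ℕ) → List (Vec (Fin n) (suc k))
chains []           n       = map (_∷ []) (allFin n)
chains (b ∷ bs)     zero    = []
chains (true  ∷ bs) (suc n) =
  map (λ ys → zero ∷ Vec.map suc ys) (chains bs n) ++ map (Vec.map suc) (chains (true ∷ bs) n)
chains (false ∷ bs) (suc n) =
  map (zero ∷_) (chains bs (suc n)) ++ map (Vec.map suc) (chains (false ∷ bs) n)

map-suc-injective : {xs ys : Vec (Fin n) k} → Vec.map Fin.suc xs ≡ Vec.map suc ys → xs ≡ ys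
map-suc-injective {xs = []}     {[]}     eq = refl
map-suc-injective {xs = x ∷ xs} {y ∷ ys} eq =
  cong₂ _∷_ (Fin.suc-injective (Vec.∷-injectiveˡ eq)) (map-suc-injective (Vec.∷-injectiveʳ eq))

zero-suc-disjoint : (f : A → Vec (Fin (suc n)) k) {xs : List A} {ys : List (Vec (Fin n) (suc k))} →
                    ∀ {v} → ¬ (v ∈ map (λ x → zero ∷ f x) xs × v ∈ map (Vec.map suc) ys)
zero-suc-disjoint f (v∈ , v∈′) with ∈.∈-map⁻ (λ x → zero ∷ f x) v∈ | ∈.∈-map⁻ (Vec.map suc) v∈′
... | _ , _ , refl | (_ ∷ _) , _ , ()

chains-unique : (bs : Vec Bool k) (n : ℕ) → List.Unique (chains bs n)
chains-unique []           n       = Unique.map⁺ Vec.∷-injectiveˡ (Unique.allFin⁺ n)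
chains-unique (b ∷ bs)     zero    = []
chains-unique (true ∷ bs)  (suc n) =
  Unique.++⁺ (Unique.map⁺ (map-suc-injective ∘ Vec.∷-injectiveʳ) (chains-unique bs n))
             (Unique.map⁺ map-suc-injective (chains-unique (true ∷ bs) n))
             (zero-suc-disjoint (Vec.map suc))
chains-unique (false ∷ bs) (suc n) =
  Unique.++⁺ (Unique.map⁺ Vec.∷-injectiveʳ (chains-unique bs (suc n)))
             (Unique.map⁺ map-suc-injective (chains-unique (false ∷ bs) n))
             (zero-suc-disjoint id)

weak≤ : (bs : Vec Bool k) → weak bs ℕ.≤ k
weak≤ []           = z≤n
weak≤ (true  ∷ bs) = ℕ.m≤n⇒m≤1+n (weak≤ bs)
weak≤ (false ∷ bs) = s≤s (weak≤ bs)

-- Pascal's rule, read off the split in `chains`: chains beginning with `zero` give the first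
-- summand, shifted chains the second.
length-chains : (bs : Vec Bool k) (n : ℕ) → length (chains bs n) ≡ (n ℕ.+ weak bs) C suc k
length-chains []       n    = begin
  length (map (_∷ []) (allFin n))  ≡⟨ length-map (_∷ []) (allFin n) ⟩
  length (allFin n)                ≡⟨ length-tabulate id ⟩
  n                                ≡⟨ sym (nC1≡n n) ⟩
  n C 1                            ≡⟨ cong (_C 1) (sym (ℕ.+-identityʳ n)) ⟩
  (n ℕ.+ 0) C 1                    ∎
  where
  open ≡-Reasoning
  open import Data.List.Properties using (length-tabulate)
-- There are at most as many weak links as links, fewer than entries, so with no letters the
-- binomial coefficient vanishes too.
length-chains (b ∷ bs)     zero    = sym (k>n⇒nCk≡0 (s≤s (weak≤ (b ∷ bs))))
length-chains {suc k} (true ∷ bs)  (suc n) = begin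
  length (chains (true ∷ bs) (suc n))
    ≡⟨ length-++ (map _ (chains bs n)) ⟩
  length (map _ (chains bs n)) ℕ.+ length (map _ (chains (true ∷ bs) n))
    ≡⟨ cong₂ ℕ._+_ (length-map _ (chains bs n)) (length-map _ (chains (true ∷ bs) n)) ⟩
  length (chains bs n) ℕ.+ length (chains (true ∷ bs) n)
    ≡⟨ cong₂ ℕ._+_ (length-chains bs n) (length-chains (true ∷ bs) n) ⟩
  (n ℕ.+ weak bs) C suc k ℕ.+ (n ℕ.+ weak bs) C suc (suc k)
    ≡⟨ nCk+nC[k+1]≡[n+1]C[k+1] (n ℕ.+ weak bs) (suc k) ⟩
  suc (n ℕ.+ weak bs) C suc (suc k) ∎
  where open ≡-Reasoning
length-chains {suc k} (false ∷ bs) (suc n) = begin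
  length (chains (false ∷ bs) (suc n))
    ≡⟨ length-++ (map _ (chains bs (suc n))) ⟩
  length (map _ (chains bs (suc n))) ℕ.+ length (map _ (chains (false ∷ bs) n))
    ≡⟨ cong₂ ℕ._+_ (length-map _ (chains bs (suc n))) (length-map _ (chains (false ∷ bs) n)) ⟩
  length (chains bs (suc n)) ℕ.+ length (chains (false ∷ bs) n)
    ≡⟨ cong₂ ℕ._+_ (length-chains bs (suc n)) (length-chains (false ∷ bs) n) ⟩
  suc (n ℕ.+ weak bs) C suc k ℕ.+ (n ℕ.+ suc (weak bs)) C suc (suc k)
    -- The upper indices agree: the first summand has one letter more and one weak link less than
    -- the second.
    ≡⟨ cong (λ m → m C suc k ℕ.+ (n ℕ.+ suc (weak bs)) C suc (suc k)) (sym (ℕ.+-suc n (weak bs))) ⟩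
  (n ℕ.+ suc (weak bs)) C suc k ℕ.+ (n ℕ.+ suc (weak bs)) C suc (suc k)
    ≡⟨ nCk+nC[k+1]≡[n+1]C[k+1] (n ℕ.+ suc (weak bs)) (suc k) ⟩
  suc (n ℕ.+ suc (weak bs)) C suc (suc k) ∎
  where open ≡-Reasoning

Chain-map-suc : (bs : Vec Bool k) {xs : Vec (Fin n) (suc k)} → Chain bs xs → Chain bs (Vec.map suc xs)
Chain-map-suc []           {x ∷ []}     _           = tt
Chain-map-suc (true  ∷ bs) {x ∷ y ∷ ys} (x<y , chn) = s≤s x<y , Chain-map-suc bs chn
Chain-map-suc (false ∷ bs) {x ∷ y ∷ ys} (x≤y , chn) = s≤s x≤y , Chain-map-suc bs chn

-- A chain never falls below its first entry, so no `zero` can follow a successor.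
chain-from-suc : (bs : Vec Bool k) (x : Fin n) (xs : Vec (Fin (suc n)) k) → Chain bs (suc x ∷ xs) →
                 ∃ λ ys → suc x ∷ xs ≡ Vec.map suc ys × Chain bs ys
chain-from-suc []           x []            _ = x ∷ [] , refl , tt
chain-from-suc (true  ∷ bs) x (suc y ∷ xs) (s≤s x<y , chn)
  with _ ∷ ys , refl , chn′ ← chain-from-suc bs y xs chn = x ∷ _ ∷ ys , refl , x<y , chn′
chain-from-suc (false ∷ bs) x (suc y ∷ xs) (s≤s x≤y , chn)
  with _ ∷ ys , refl , chn′ ← chain-from-suc bs y xs chn = x ∷ _ ∷ ys , refl , x≤y , chn′

∈-chains⁻ : (bs : Vec Bool k) (n : ℕ) {xs : Vec (Fin n) (suc k)} → xs ∈ chains bs n → Chain bs xs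
∈-chains⁻ []           n       {x ∷ []} _ = tt
∈-chains⁻ (true  ∷ bs) (suc n) xs∈ with ∈.∈-++⁻ (map _ (chains bs n)) xs∈
... | inj₁ xs∈ˡ with y ∷ ys , ys∈ , refl ← ∈.∈-map⁻ _ xs∈ˡ = s≤s z≤n , Chain-map-suc bs (∈-chains⁻ bs n ys∈)
... | inj₂ xs∈ʳ with ys , ys∈ , refl ← ∈.∈-map⁻ _ xs∈ʳ = Chain-map-suc (true ∷ bs) (∈-chains⁻ (true ∷ bs) n ys∈)
∈-chains⁻ (false ∷ bs) (suc n) xs∈ with ∈.∈-++⁻ (map _ (chains bs (suc n))) xs∈
... | inj₁ xs∈ˡ with y ∷ ys , ys∈ , refl ← ∈.∈-map⁻ _ xs∈ˡ = z≤n , ∈-chains⁻ bs (suc n) ys∈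
... | inj₂ xs∈ʳ with ys , ys∈ , refl ← ∈.∈-map⁻ _ xs∈ʳ = Chain-map-suc (false ∷ bs) (∈-chains⁻ (false ∷ bs) n ys∈)

∈-chains⁺ : (bs : Vec Bool k) (n : ℕ) {xs : Vec (Fin n) (suc k)} → Chain bs xs → xs ∈ chains bs n
∈-chains⁺ []           n       {x ∷ []} _ = ∈.∈-map⁺ (_∷ []) (∈.∈-allFin x)
∈-chains⁺ (true  ∷ bs) (suc n) {zero ∷ suc y ∷ xs} (_ , chn)
  with ys , eq , chn′ ← chain-from-suc bs y xs chn =
  ∈.∈-++⁺ˡ (subst (λ v → zero ∷ v ∈ map (λ ys → zero ∷ Vec.map suc ys) (chains bs n)) (sym eq)
    (∈.∈-map⁺ (λ ys → zero ∷ Vec.map suc ys) (∈-chains⁺ bs n chn′)))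
∈-chains⁺ (false ∷ bs) (suc n) {zero ∷ xs} chn =
  ∈.∈-++⁺ˡ (∈.∈-map⁺ (zero ∷_) (∈-chains⁺ bs (suc n) (weak-tail xs chn)))
  where
  weak-tail : ∀ xs → Chain (false ∷ bs) (zero ∷ xs) → Chain bs xs
  weak-tail (_ ∷ _) = proj₂
∈-chains⁺ (true  ∷ bs) (suc n) {suc x ∷ xs} chn
  with ys , eq , chn′ ← chain-from-suc (true ∷ bs) x xs chn =
  ∈.∈-++⁺ʳ _ (subst (_∈ map (Vec.map suc) (chains (true ∷ bs) n)) (sym eq)
    (∈.∈-map⁺ (Vec.map suc) (∈-chains⁺ (true ∷ bs) n chn′)))
∈-chains⁺ (false ∷ bs) (suc n) {suc x ∷ xs} chn
  with ys , eq , chn′ ← chain-from-suc (false ∷ bs) x xs chn =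
  ∈.∈-++⁺ʳ _ (subst (_∈ map (Vec.map suc) (chains (false ∷ bs) n)) (sym eq)
    (∈.∈-map⁺ (Vec.map suc) (∈-chains⁺ (false ∷ bs) n chn′)))

-- Permutations and their relative order

-- Pigeonhole principle: if `y` were missed, punching it out would leave an injection into a set
-- with one element less.
injective⇒surjective : {f : Fin n → Fin n} → (∀ {i j} → f i ≡ f j → i ≡ j) → ∀ y → ∃ λ x → f x ≡ y
injective⇒surjective {suc n} {f} inj y with Fin.any? (λ x → f x Fin.≟ y)
... | yes found = found
... | no  missed = contradiction (Fin.injective⇒≤ {f = λ x → punchOut (y≢f x)}
                     (inj ∘ Fin.punchOut-injective (y≢f _) (y≢f _))) ℕ.1+n≰n
  where
  y≢f : ∀ x → y ≢ f x
  y≢f x y≡fx = missed (x , sym y≡fx)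

module Permutation {σ : Vec (Fin n) n} (σ! : Vec.Unique σ) where

  injective : ∀ {i j} → lookup σ i ≡ lookup σ j → i ≡ j
  injective = VecUnique.lookup-injective σ! _ _

  surjective : ∀ y → ∃ λ x → lookup σ x ≡ y
  surjective = injective⇒surjective injective

  ≮⇒> : ∀ {i j} → i Fin.< j → ¬ (lookup σ i Fin.< lookup σ j) → lookup σ j Fin.< lookup σ i
  ≮⇒> {i} {j} i<j ≮ with Fin.<-cmp (lookup σ i) (lookup σ j)
  ... | tri< lt _ _ = contradiction lt ≮
  ... | tri≈ _ eq _ = contradiction (injective eq) (Fin.<⇒≢ i<j)
  ... | tri> _ _ gt = gt

-- If σ i > τ i, then the position j of the value τ i in σ satisfies
-- σ j = τ i > τ j, and σ j < σ i; this cannot go on for ever.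
order⇒≤ : {σ τ : Vec (Fin n) n} → Vec.Unique σ →
          (∀ {i j} → lookup σ i Fin.< lookup σ j → lookup τ i Fin.< lookup τ j) →
          ∀ i → lookup σ i Fin.≤ lookup τ i
order⇒≤ {σ = σ} {τ} σ! mono i = ℕ.≮⇒≥ (descend _ i ℕ.≤-refl)
  where
  descend : ∀ m i → toℕ (lookup σ i) ℕ.< m → ¬ (lookup τ i Fin.< lookup σ i)
  descend (suc m) i (s≤s σi≤m) τi<σi with j , σj≡τi ← Permutation.surjective σ! (lookup τ i) =
    descend m j (ℕ.<-≤-trans σj<σi σi≤m) (subst (lookup τ j Fin.<_) (sym σj≡τi) (mono σj<σi))
    where
    σj<σi : lookup σ j Fin.< lookup σ i
    σj<σi = subst (Fin._< lookup σ i) (sym σj≡τi) τi<σi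

Inversion : Vec (Fin n) n → Fin n → Fin n → Set
Inversion σ i j = lookup σ j Fin.< lookup σ i

-- The inversions decide the comparison of letters at any two positions, in either order of the
-- positions. So `order⇒≤` applies in both directions, and antisymmetry finishes.
order⇒≡ : {σ τ : Vec (Fin n) n} → Vec.Unique σ → Vec.Unique τ →
          (∀ {i j} → i Fin.< j → Inversion σ i j ⇔ Inversion τ i j) → σ ≡ τ
order⇒≡ {σ = σ} {τ} σ! τ! same = begin
  σ                    ≡⟨ Vec.tabulate∘lookup σ ⟨
  tabulate (lookup σ)  ≡⟨ Vec.tabulate-cong (λ i → Fin.≤-antisym
                            (order⇒≤ {σ = σ} {τ} σ! (mono σ! τ! same) i)
                            (order⇒≤ {σ = τ} {σ} τ! (mono τ! σ! λ i<j →
                              mk⇔ (Equivalence.from (same i<j)) (Equivalence.to (same i<j))) i)) ⟩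
  tabulate (lookup τ)  ≡⟨ Vec.tabulate∘lookup τ ⟩
  τ                    ∎
  where
  open ≡-Reasoning
  mono : {σ τ : Vec (Fin n) n} → Vec.Unique σ → Vec.Unique τ →
         (∀ {i j} → i Fin.< j → Inversion σ i j ⇔ Inversion τ i j) →
         ∀ {i j} → lookup σ i Fin.< lookup σ j → lookup τ i Fin.< lookup τ j
  mono {σ = σ} {τ} σ! τ! same {i} {j} σi<σj with Fin.<-cmp i j
  ... | tri≈ _ refl _ = contradiction σi<σj (ℕ.<-irrefl refl)
  ... | tri> _ _ j<i  = Equivalence.to (same j<i) σi<σj
  ... | tri< i<j _ _ with lookup τ i Fin.<? lookup τ j
  ...   | yes τi<τj = τi<τj
  ...   | no  τi≮τj =
    contradiction (Equivalence.from (same i<j) (Permutation.≮⇒> τ! i<j τi≮τj)) (ℕ.<-asym σi<σj)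

-- Exchanging two adjacent blocks

-- Place c e i v: the permutation swap c e below has the letter v at position i.
data Place (c e i : ℕ) : ℕ → Set where
  before : i ℕ.< c → Place c e i (i ℕ.+ (suc e ℕ.∸ c))
  within : c ℕ.≤ i → i ℕ.≤ e → Place c e i (i ℕ.∸ c)
  after  : c ℕ.≤ i → e ℕ.< i → Place c e i i

place : ∀ c e i → ∃ (Place c e i)
place c e i with i ℕ.<? c | i ℕ.≤? e
... | yes i<c | _       = _ , before i<c
... | no  i≮c | yes i≤e = _ , within (ℕ.≮⇒≥ i≮c) i≤e
... | no  i≮c | no  i≰e = _ , after (ℕ.≮⇒≥ i≮c) (ℕ.≰⇒> i≰e)

-- By truncated subtraction, c + (`suc e ∸ c`) is the maximum of c and e+1, also in the degenerate
-- case c > e. The bound serves both for comparing with later letters and, with `j` the size of the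
-- alphabet, for staying inside it.
before-< : ∀ {c e i j} → i ℕ.< c → c ℕ.≤ j → e ℕ.< j → i ℕ.+ (suc e ℕ.∸ c) ℕ.< j
before-< {c} {e} {i} {j} i<c c≤j e<j = begin-strict
  i ℕ.+ (suc e ℕ.∸ c)  <⟨ ℕ.+-monoˡ-< (suc e ℕ.∸ c) i<c ⟩
  c ℕ.+ (suc e ℕ.∸ c)  ≤⟨ ℕ.+-monoʳ-≤ c (ℕ.∸-monoˡ-≤ c e<j) ⟩
  c ℕ.+ (j ℕ.∸ c)      ≡⟨ ℕ.m+[n∸m]≡n c≤j ⟩
  j                    ∎
  where open ℕ.≤-Reasoning

place-< : ∀ {c e i v n} → Place c e i v → c ℕ.< n → e ℕ.< n → i ℕ.< n → v ℕ.< n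
place-< (before i<c)         c<n e<n i<n = before-< i<c (ℕ.<⇒≤ c<n) e<n
place-< {c} {i = i} (within _ _) c<n e<n i<n = ℕ.≤-<-trans (ℕ.m∸n≤m i c) i<n
place-< (after _ _)          c<n e<n i<n = i<n

abstract

  -- In one-line notation: e+1−c, …, e, 0, …, e−c, e+1, …, n−1.  This is the
  -- identity when c = 0 or c > e.
  swap : (c e : Fin n) → Vec (Fin n) n
  swap c e = tabulate λ i →
    fromℕ< (place-< (proj₂ (place (toℕ c) (toℕ e) (toℕ i))) (toℕ<n c) (toℕ<n e) (toℕ<n i))

  -- All later reasoning about the letters of `swap` rests on this description; the definition
  -- itself stays folded.
  lookup-swap : (c e i : Fin n) → Place (toℕ c) (toℕ e) (toℕ i) (toℕ (lookup (swap c e) i))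
  lookup-swap c e i = subst (Place (toℕ c) (toℕ e) (toℕ i))
    (sym (trans (cong toℕ (Vec.lookup∘tabulate _ i)) (toℕ-fromℕ< _)))
    (proj₂ (place (toℕ c) (toℕ e) (toℕ i)))

Exchanged : Fin n → Fin n → Fin n → Fin n → Set
Exchanged c e i j = i Fin.< c × c Fin.≤ j × j Fin.≤ e

-- Letters increase within each of the three segments, and those after both blocks exceed all
-- earlier ones. Only a position of the first block against one of the second reverses the order.
place-order : ∀ {c e i j v w} → Place c e i v → Place c e j w → i ℕ.< j →
              (v ℕ.< w × ¬ (i ℕ.< c × c ℕ.≤ j × j ℕ.≤ e)) ⊎ (w ℕ.< v × i ℕ.< c × c ℕ.≤ j × j ℕ.≤ e)
place-order {c} {e} (before _) (before j<c) i<j =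
  inj₁ (ℕ.+-monoˡ-< (suc e ℕ.∸ c) i<j , λ (_ , c≤j , _) → ℕ.<⇒≱ j<c c≤j)
place-order {c} {i = i} (before i<c) (within c≤j j≤e) i<j =
  -- Letters in the second block lie below `suc e ∸ c`, the amount added to every letter of the
  -- first.
  inj₂ (ℕ.<-≤-trans (ℕ.∸-monoˡ-< (s≤s j≤e) c≤j) (ℕ.m≤n+m _ i) , i<c , c≤j , j≤e)
place-order (before i<c) (after c≤j e<j) i<j =
  inj₁ (before-< i<c c≤j e<j , λ (_ , _ , j≤e) → ℕ.<⇒≱ e<j j≤e)
place-order (within c≤i _) (before j<c) i<j = contradiction (ℕ.<-trans i<j j<c) (ℕ.≤⇒≯ c≤i)
place-order (within c≤i _) (within _ _) i<j =
  inj₁ (ℕ.∸-monoˡ-< i<j c≤i , λ (i<c , _) → ℕ.<⇒≱ i<c c≤i)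
place-order {c} {i = i} (within c≤i _) (after _ _) i<j =
  inj₁ (ℕ.≤-<-trans (ℕ.m∸n≤m i c) i<j , λ (i<c , _) → ℕ.<⇒≱ i<c c≤i)
place-order (after c≤i _) (before j<c) i<j = contradiction (ℕ.<-trans i<j j<c) (ℕ.≤⇒≯ c≤i)
place-order (after _ e<i) (within _ j≤e) i<j = contradiction (ℕ.<-≤-trans i<j j≤e) (ℕ.<⇒≯ e<i)
place-order (after c≤i _) (after _ _) i<j = inj₁ (i<j , λ (i<c , _) → ℕ.<⇒≱ i<c c≤i)

module _ (c e : Fin n) {i j : Fin n} (i<j : i Fin.< j) where

  private order = place-order (lookup-swap c e i) (lookup-swap c e j) i<j

  inversion-swap : Inversion (swap c e) i j ⇔ Exchanged c e i j
  inversion-swap with order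
  ... | inj₁ (σi<σj , ¬ex) = mk⇔ (λ σj<σi → contradiction σj<σi (ℕ.<-asym σi<σj)) (λ ex → contradiction ex ¬ex)
  ... | inj₂ (σj<σi , ex)  = mk⇔ (λ _ → ex) (λ _ → σj<σi)

  exchanged : Inversion (swap c e) i j → Exchanged c e i j
  exchanged = Equivalence.to inversion-swap

  not-exchanged : lookup (swap c e) i Fin.< lookup (swap c e) j → ¬ Exchanged c e i j
  not-exchanged σi<σj ex = ℕ.<-asym σi<σj (Equivalence.from inversion-swap ex)

  swap-ascent : ¬ Exchanged c e i j → lookup (swap c e) i Fin.< lookup (swap c e) j
  swap-ascent ¬ex with order
  ... | inj₁ (σi<σj , _) = σi<σj
  ... | inj₂ (_ , ex)    = contradiction ex ¬ex

  swap-distinct : lookup (swap c e) i ≢ lookup (swap c e) j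
  swap-distinct with order
  ... | inj₁ (σi<σj , _) = Fin.<⇒≢ σi<σj
  ... | inj₂ (σj<σi , _) = Fin.<⇒≢ σj<σi ∘ sym

exchanged⇒< : (c e : Fin n) {i j : Fin n} → Exchanged c e i j → i Fin.< j
exchanged⇒< c e (i<c , c≤j , _) = ℕ.<-≤-trans i<c c≤j

swap-unique : (c e : Fin n) → Vec.Unique (swap c e)
swap-unique c e = subst Vec.Unique (Vec.tabulate∘lookup (swap c e)) (VecUnique.tabulate⁺ injective)
  where
  injective : ∀ {i j} → lookup (swap c e) i ≡ lookup (swap c e) j → i ≡ j
  injective {i} {j} eq with Fin.<-cmp i j
  ... | tri< i<j _ _ = contradiction eq (swap-distinct c e i<j)
  ... | tri≈ _ i≡j _ = i≡j
  ... | tri> _ _ j<i = contradiction (sym eq) (swap-distinct c e j<i)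

swap-exchanged : (c e c′ e′ : Fin n) {i j : Fin n} → swap c e ≡ swap c′ e′ →
                 Exchanged c e i j → Exchanged c′ e′ i j
swap-exchanged c e c′ e′ {i} {j} eq ex =
  Equivalence.to (inversion-swap c′ e′ i<j)
    (subst (λ σ → Inversion σ i j) eq (Equivalence.from (inversion-swap c e i<j) ex))
  where i<j = exchanged⇒< c e ex

-- If (i, j) is exchanged, so are (i, c) and (i, e). Read in the other description of the same
-- permutation, these give c′ ≤ c and e ≤ e′; symmetry gives the converse bounds. The exchanged
-- pairs exclude the degenerate descriptions of the identity.
swap-injective : (c e c′ e′ : Fin n) {i j i′ j′ : Fin n} →
                 Exchanged c e i j → Exchanged c′ e′ i′ j′ →
                 swap c e ≡ swap c′ e′ → c ≡ c′ × e ≡ e′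
swap-injective c e c′ e′ ex ex′ eq =
  Fin.≤-antisym (proj₁ (bounds c′ e′ c e ex′ (sym eq))) (proj₁ (bounds c e c′ e′ ex eq)) ,
  Fin.≤-antisym (proj₂ (bounds c e c′ e′ ex eq)) (proj₂ (bounds c′ e′ c e ex′ (sym eq)))
  where
  bounds : (c e c′ e′ : Fin n) {i j : Fin n} → Exchanged c e i j → swap c e ≡ swap c′ e′ →
           c′ Fin.≤ c × e Fin.≤ e′
  bounds c e c′ e′ {i} (i<c , c≤j , j≤e) eq =
    proj₁ (proj₂ (swap-exchanged c e c′ e′ {i} {c} eq (i<c , ℕ.≤-refl , ℕ.≤-trans c≤j j≤e))) ,
    proj₂ (proj₂ (swap-exchanged c e c′ e′ {i} {e} eq (i<c , ℕ.≤-trans c≤j j≤e , ℕ.≤-refl)))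

-- Patterns of length three

increasing : {i j l : Fin n} → i Fin.< j → j Fin.< l → AllPairs Fin._<_ (i ∷ j ∷ l ∷ [])
increasing i<j j<l = (i<j VecAll.∷ ℕ.<-trans i<j j<l VecAll.∷ VecAll.[]) ∷ (j<l VecAll.∷ VecAll.[]) ∷ VecAll.[] ∷ []

-- The vector r is the inverse of q: it holds the positions of the values 0, 1, 2.
occurrence⁺ : (q r : Vec (Fin 3) 3) → (∀ j → lookup r (lookup q j) ≡ j) →
              (σ : Vec (Fin n) n) {i j l : Fin n} → i Fin.< j → j Fin.< l →
              (let v = λ t → lookup σ (lookup (i ∷ j ∷ l ∷ []) (lookup r t))) →
              v 0F Fin.< v 1F → v 1F Fin.< v 2F → Occurrence q σ (i ∷ j ∷ l ∷ [])
occurrence⁺ q r rq≡id σ {i} {j} {l} i<j j<l v₀<v₁ v₁<v₂ =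
  increasing i<j j<l , λ a b → mk⇔ to (from a b)
  where
  v : Fin 3 → Fin _
  v t = lookup σ (lookup (i ∷ j ∷ l ∷ []) (lookup r t))
  v-mono : ∀ {s t} → s Fin.< t → v s Fin.< v t
  v-mono {0F} {1F} _ = v₀<v₁
  v-mono {0F} {2F} _ = ℕ.<-trans v₀<v₁ v₁<v₂
  v-mono {1F} {2F} _ = v₁<v₂
  v-mono {1F} {1F} (s≤s ())
  v-mono {2F} {1F} (s≤s ())
  v-mono {2F} {2F} (s≤s (s≤s ()))
  to : ∀ {a b} → lookup q a Fin.< lookup q b →
       lookup σ (lookup (i ∷ j ∷ l ∷ []) a) Fin.< lookup σ (lookup (i ∷ j ∷ l ∷ []) b)
  to {a} {b} lt = subst₂ (λ a b → lookup σ (lookup (i ∷ j ∷ l ∷ []) a) Fin.< lookup σ (lookup (i ∷ j ∷ l ∷ []) b))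
                    (rq≡id a) (rq≡id b) (v-mono lt)
  from : ∀ a b → lookup σ (lookup (i ∷ j ∷ l ∷ []) a) Fin.< lookup σ (lookup (i ∷ j ∷ l ∷ []) b) →
         lookup q a Fin.< lookup q b
  from a b lt with Fin.<-cmp (lookup q a) (lookup q b)
  ... | tri< qa<qb _ _ = qa<qb
  ... | tri> _ _ qb<qa = contradiction lt (ℕ.<-asym (to {b} {a} qb<qa))
  -- The left inverse `r` makes `q` injective, so `a` and `b` coincide.
  ... | tri≈ _ qa≡qb _ with refl ← trans (sym (rq≡id a)) (trans (cong (lookup r) qa≡qb) (rq≡id b)) =
    contradiction lt (ℕ.<-irrefl refl)

module _ (σ : Vec (Fin n) n) {i j l : Fin n} (i<j : i Fin.< j) (j<l : j Fin.< l) where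

  private
    σi = lookup σ i
    σj = lookup σ j
    σl = lookup σ l

  occurrence-123 : σi Fin.< σj → σj Fin.< σl → Occurrence p123 σ (i ∷ j ∷ l ∷ [])
  occurrence-123 = occurrence⁺ p123 p123 (λ { 0F → refl ; 1F → refl ; 2F → refl }) σ i<j j<l

  occurrence-132 : σi Fin.< σl → σl Fin.< σj → Occurrence p132 σ (i ∷ j ∷ l ∷ [])
  occurrence-132 = occurrence⁺ p132 p132 (λ { 0F → refl ; 1F → refl ; 2F → refl }) σ i<j j<l

  occurrence-213 : σj Fin.< σi → σi Fin.< σl → Occurrence p213 σ (i ∷ j ∷ l ∷ [])
  occurrence-213 = occurrence⁺ p213 p213 (λ { 0F → refl ; 1F → refl ; 2F → refl }) σ i<j j<l

  occurrence-231 : σl Fin.< σi → σi Fin.< σj → Occurrence p231 σ (i ∷ j ∷ l ∷ [])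
  -- 231 and 312 are inverse to each other; the other four patterns are involutions.
  occurrence-231 = occurrence⁺ p231 p312 (λ { 0F → refl ; 1F → refl ; 2F → refl }) σ i<j j<l

  occurrence-312 : σj Fin.< σl → σl Fin.< σi → Occurrence p312 σ (i ∷ j ∷ l ∷ [])
  occurrence-312 = occurrence⁺ p312 p231 (λ { 0F → refl ; 1F → refl ; 2F → refl }) σ i<j j<l

  occurrence-321 : σl Fin.< σj → σj Fin.< σi → Occurrence p321 σ (i ∷ j ∷ l ∷ [])
  occurrence-321 = occurrence⁺ p321 p321 (λ { 0F → refl ; 1F → refl ; 2F → refl }) σ i<j j<l

increasing⁻ : {i j l : Fin n} → AllPairs Fin._<_ (i ∷ j ∷ l ∷ []) → i Fin.< j × j Fin.< l
increasing⁻ ((i<j VecAll.∷ _) ∷ (j<l VecAll.∷ _) ∷ _) = i<j , j<l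

occurrence-order : (q : Vec (Fin k) k) (σ : Vec (Fin n) n) {is : Vec (Fin n) k} → Occurrence q σ is →
                   ∀ a b → lookup q a Fin.< lookup q b →
                   lookup σ (lookup is a) Fin.< lookup σ (lookup is b)
occurrence-order q σ (_ , order) a b = Equivalence.to (order a b)

occurrences-disjoint : (q q′ : Vec (Fin k) k) (a b : Fin k) →
                       lookup q a Fin.< lookup q b → ¬ (lookup q′ a Fin.< lookup q′ b) →
                       (σ : Vec (Fin n) n) {is : Vec (Fin n) k} → Occurrence q σ is → ¬ Occurrence q′ σ is
occurrences-disjoint q q′ a b q< q′≮ σ o o′ =
  q′≮ (Equivalence.from (proj₂ o′ a b) (occurrence-order q σ o a b q<))

-- The permutations avoiding 132 and 321

record Avoiding (σ : Vec (Fin n) n) : Set where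
  field
    unique : Vec.Unique σ
    no132  : ∀ is → ¬ Occurrence p132 σ is
    no321  : ∀ is → ¬ Occurrence p321 σ is

toℕ-pred : (i : Fin n) → toℕ (Fin.pred i) ≡ ℕ.pred (toℕ i)
toℕ-pred zero    = refl
toℕ-pred (suc i) = Fin.toℕ-inject₁ i

-- c is the position of the letter 0 and e that of the predecessor of the
-- first letter (with e = c = 0 when the first letter is 0).
module _ {m} {σ : Vec (Fin (suc m)) (suc m)} (av : Avoiding σ) where

  open Avoiding av
  open Permutation unique

  private
    c e : Fin (suc m)
    c = proj₁ (surjective zero)
    e = proj₁ (surjective (Fin.pred (lookup σ zero)))

    σc≡0 : toℕ (lookup σ c) ≡ 0
    σc≡0 = cong toℕ (proj₂ (surjective zero))

    σe≡ : toℕ (lookup σ e) ≡ ℕ.pred (toℕ (lookup σ zero))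
    σe≡ = trans (cong toℕ (proj₂ (surjective (Fin.pred (lookup σ zero))))) (toℕ-pred (lookup σ zero))

    σc-minimum : ∀ {i} → i ≢ c → lookup σ c Fin.< lookup σ i
    σc-minimum {i} i≢c = subst (ℕ._< toℕ (lookup σ i)) (sym σc≡0)
      (ℕ.n≢0⇒n>0 λ σi≡0 → i≢c (injective (toℕ-injective (trans σi≡0 (sym σc≡0)))))

    no-132 : ∀ {i j l} → i Fin.< j → j Fin.< l → lookup σ i Fin.< lookup σ l → lookup σ j Fin.≤ lookup σ l
    no-132 i<j j<l σi<σl = ℕ.≮⇒≥ (no132 _ ∘ occurrence-132 σ i<j j<l σi<σl)

    no-321 : ∀ {i j l} → i Fin.< j → j Fin.< l → lookup σ l Fin.< lookup σ j → lookup σ i Fin.≤ lookup σ j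
    no-321 i<j j<l σl<σj = ℕ.≮⇒≥ (no321 _ ∘ occurrence-321 σ i<j j<l σl<σj)

    -- A descent here, followed by the letter 0 at `c`, would be a 321.
    increasing-before : ∀ {i j} → i Fin.≤ j → j Fin.< c → lookup σ i Fin.≤ lookup σ j
    increasing-before {i} {j} i≤j j<c with i Fin.≟ j
    ... | yes refl = ℕ.≤-refl
    ... | no  i≢j  = no-321 (Fin.≤∧≢⇒< i≤j i≢j) j<c (σc-minimum (Fin.<⇒≢ j<c))

    -- A descent here, preceded by the letter 0 at `c`, would be a 132.
    increasing-after : ∀ {i j} → c Fin.≤ i → i Fin.≤ j → lookup σ i Fin.≤ lookup σ j
    increasing-after {i} {j} c≤i i≤j with i Fin.≟ j | c Fin.≟ i
    ... | yes refl | _        = ℕ.≤-refl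
    ... | no  i≢j  | yes refl = subst (ℕ._≤ toℕ (lookup σ j)) (sym σc≡0) z≤n
    ... | no  i≢j  | no c≢i   =
      no-132 (Fin.≤∧≢⇒< c≤i c≢i) i<j (σc-minimum (Fin.<⇒≢ (ℕ.<-trans (Fin.≤∧≢⇒< c≤i c≢i) i<j) ∘ sym))
      where i<j = Fin.≤∧≢⇒< i≤j i≢j

    -- Once some position precedes `c`, the first letter is not 0 and its predecessor is a genuine
    -- one.
    σe<σ0 : ∀ {i : Fin (suc m)} → i Fin.< c → lookup σ e Fin.< lookup σ zero
    σe<σ0 {i} i<c = subst (ℕ._< toℕ (lookup σ zero)) (sym σe≡) (ℕ.≤-reflexive (ℕ.suc-pred _ {{ℕ.>-nonZero 0<σ0}}))
      where
      0<σ0 : 0 ℕ.< toℕ (lookup σ zero)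
      0<σ0 = ℕ.≤-<-trans z≤n (σc-minimum {zero} λ 0≡c → contradiction (subst (i Fin.<_) (sym 0≡c) i<c) λ ())

  -- Letters increase before `c` and again from `c` on, so an inversion straddles `c`. Its smaller
  -- letter is below the first letter, hence at most the letter at `e`, which bounds its position by
  -- `e`. Conversely, σ j ≤ σ e < σ 0 ≤ σ i.
  inversion-avoiding : ∀ {i j} → i Fin.< j → Inversion σ i j ⇔ Exchanged c e i j
  inversion-avoiding {i} {j} i<j = mk⇔ to from
    where
    to : Inversion σ i j → Exchanged c e i j
    to σj<σi = i<c , c≤j , ℕ.≮⇒≥ e≮j
      where
      i<c : i Fin.< c
      i<c = ℕ.≰⇒> λ c≤i → ℕ.<⇒≱ σj<σi (increasing-after c≤i (ℕ.<⇒≤ i<j))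
      c≤j : c Fin.≤ j
      c≤j = ℕ.≮⇒≥ λ j<c → ℕ.<⇒≱ σj<σi (increasing-before (ℕ.<⇒≤ i<j) j<c)
      c≤e : c Fin.≤ e
      c≤e = ℕ.≮⇒≥ λ e<c → ℕ.<⇒≱ (σe<σ0 i<c) (increasing-before z≤n e<c)
      σj≤σ0 : lookup σ j Fin.≤ lookup σ zero
      σj≤σ0 with i Fin.≟ zero
      ... | yes i≡0 = ℕ.<⇒≤ (subst (λ k → lookup σ j Fin.< lookup σ k) i≡0 σj<σi)
      -- Otherwise positions 0, i, j would form a 132.
      ... | no  i≢0 = ℕ.≮⇒≥ λ σ0<σj →
        ℕ.<⇒≱ σj<σi (no-132 (Fin.≤∧≢⇒< z≤n (i≢0 ∘ sym)) i<j σ0<σj)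
      j≢0 : j ≢ zero
      j≢0 j≡0 = contradiction (subst (i Fin.<_) j≡0 i<j) λ ()
      σj<σ0 : lookup σ j Fin.< lookup σ zero
      σj<σ0 = Fin.≤∧≢⇒< σj≤σ0 (j≢0 ∘ injective)
      e≮j : ¬ (e Fin.< j)
      -- The letter at `e` is the largest one below the first letter, so a later `j` would have to
      -- carry that same letter.
      e≮j e<j = Fin.<⇒≢ e<j (injective (Fin.≤-antisym (increasing-after c≤e (ℕ.<⇒≤ e<j))
        (subst (toℕ (lookup σ j) ℕ.≤_) (sym σe≡) (ℕ.<⇒≤pred σj<σ0))))
    from : Exchanged c e i j → Inversion σ i j
    from (i<c , c≤j , j≤e) = begin-strict
      toℕ (lookup σ j)     ≤⟨ increasing-after c≤j j≤e ⟩
      toℕ (lookup σ e)     <⟨ σe<σ0 i<c ⟩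
      toℕ (lookup σ zero)  ≤⟨ increasing-before z≤n i<c ⟩
      toℕ (lookup σ i)     ∎
      where open ℕ.≤-Reasoning

  avoiding⇒swap : ∃₂ λ c e → σ ≡ swap c e
  avoiding⇒swap = c , e , order⇒≡ unique (swap-unique c e) λ i<j →
    mk⇔ (Equivalence.from (inversion-swap c e i<j) ∘ Equivalence.to (inversion-avoiding i<j))
        (Equivalence.from (inversion-avoiding i<j) ∘ Equivalence.to (inversion-swap c e i<j))

-- In a 132 the last two positions are exchanged; the first then also precedes `c`, so it is
-- exchanged with the last, against the pattern. In a 321 the middle position would lie on both
-- sides of `c`.
swap-avoiding : (c e : Fin n) → Avoiding (swap c e)
swap-avoiding c e = record { unique = swap-unique c e ; no132 = no132 ; no321 = no321 }
  where
  no132 : ∀ is → ¬ Occurrence p132 (swap c e) is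
  no132 (i ∷ j ∷ l ∷ []) o
    with i<j , j<l ← increasing⁻ (proj₁ o)
    with j<c , c≤l , l≤e ← exchanged c e j<l (occurrence-order p132 (swap c e) o 2F 1F (s≤s (s≤s z≤n))) =
    not-exchanged c e (ℕ.<-trans i<j j<l) (occurrence-order p132 (swap c e) o 0F 2F (s≤s z≤n))
      (ℕ.<-trans i<j j<c , c≤l , l≤e)
  no321 : ∀ is → ¬ Occurrence p321 (swap c e) is
  no321 (i ∷ j ∷ l ∷ []) o
    with i<j , j<l ← increasing⁻ (proj₁ o)
    with _ , c≤j , _ ← exchanged c e i<j (occurrence-order p321 (swap c e) o 1F 0F (s≤s (s≤s z≤n)))
    with j<c , _ ← exchanged c e j<l (occurrence-order p321 (swap c e) o 2F 1F (s≤s z≤n)) =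
    ℕ.<⇒≱ j<c c≤j

-- Membership in the enumerated lists

words-unique : ∀ n k → List.Unique (words n k)
words-unique n zero    = All.[] ∷ []
words-unique n (suc k) =
  Unique.cartesianProductWith⁺ _∷_ Vec.∷-injective (Unique.allFin⁺ n) (words-unique n k)

∈-words : (v : Vec (Fin n) k) → v ∈ words n k
∈-words []      = here refl
∈-words (x ∷ v) = ∈.∈-cartesianProductWith⁺ _∷_ (∈.∈-allFin x) (∈-words v)

S[132,321]-unique : ∀ n → List.Unique (S[132,321] n)
S[132,321]-unique n = Unique.filter⁺ _ (Unique.filter⁺ unique? (words-unique n n))

avoids⁻ : (q : Vec (Fin k) k) (σ : Vec (Fin n) n) → Avoids q σ → ∀ is → ¬ Occurrence q σ is
avoids⁻ {k} {n} q σ avoids is o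
  with filter (occurrence? q σ) (words n k) | ∈.∈-filter⁺ (occurrence? q σ) (∈-words is) o
... | [] | ()

avoids⁺ : (q : Vec (Fin k) k) (σ : Vec (Fin n) n) → (∀ is → ¬ Occurrence q σ is) → Avoids q σ
avoids⁺ {k} {n} q σ none =
  cong length (filter-none (occurrence? q σ) {xs = words n k} (All.universal none _))

∈-S[132,321]⁻ : {σ : Vec (Fin n) n} → σ ∈ S[132,321] n → Avoiding σ
∈-S[132,321]⁻ {n} {σ} σ∈ with σ∈S , no132 , no321 ← ∈.∈-filter⁻ _ {xs = S n} σ∈ = record
  { unique = proj₂ (∈.∈-filter⁻ unique? {xs = words n n} σ∈S)
  ; no132  = avoids⁻ p132 σ no132
  ; no321  = avoids⁻ p321 σ no321
  }

∈-S[132,321]⁺ : {σ : Vec (Fin n) n} → Avoiding σ → σ ∈ S[132,321] n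
∈-S[132,321]⁺ {σ = σ} av = ∈.∈-filter⁺ _ (∈.∈-filter⁺ unique? (∈-words σ) unique)
  (avoids⁺ p132 σ no132 , avoids⁺ p321 σ no321)
  where open Avoiding av

∈-S[132,321]⇒swap : ∀ {m} {σ : Vec (Fin (suc m)) (suc m)} → σ ∈ S[132,321] (suc m) → ∃₂ λ c e → σ ≡ swap c e
∈-S[132,321]⇒swap σ∈ = avoiding⇒swap (∈-S[132,321]⁻ σ∈)

-- Counting

-- The identity is represented by the pair (0, 0), every other permutation by a unique pair 1 ≤ c ≤
-- e ≤ m. Shifted down by one, these pairs are the weak chains of two among `m` letters.
length-S[132,321] : ∀ m → length (S[132,321] (suc m)) ≡ suc (suc m C 2)
length-S[132,321] m = begin
  length (S[132,321] (suc m))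
    ≡⟨ length-bijection swap′ (S[132,321]-unique (suc m)) cuts-unique (λ {y} {y′} → injective y y′) into onto ⟩
  suc (length (map (Vec.map suc) (chains (false ∷ []) m)))
    ≡⟨ cong suc (length-map (Vec.map suc) (chains (false ∷ []) m)) ⟩
  suc (length (chains (false ∷ []) m))
    ≡⟨ cong suc (length-chains (false ∷ []) m) ⟩
  suc ((m ℕ.+ 1) C 2)
    ≡⟨ cong (λ n → suc (n C 2)) (ℕ.+-comm m 1) ⟩
  suc (suc m C 2) ∎
  where
  open ≡-Reasoning
  swap′ : Vec (Fin (suc m)) 2 → Vec (Fin (suc m)) (suc m)
  swap′ (c ∷ e ∷ []) = swap c e
  proper cuts : List (Vec (Fin (suc m)) 2)
  proper = map (Vec.map suc) (chains (false ∷ []) m)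
  cuts   = (zero ∷ zero ∷ []) ∷ proper
  Proper : Vec (Fin (suc m)) 2 → Set
  -- Positions 0 and `e` witness that such a cut is not degenerate, as `swap-injective` requires.
  Proper (c ∷ e ∷ []) = Exchanged c e zero e
  ∈-proper⁻ : ∀ {y} → y ∈ proper → Proper y
  ∈-proper⁻ y∈ with (c ∷ e ∷ []) , v∈ , refl ← ∈.∈-map⁻ (Vec.map suc) y∈ =
    s≤s z≤n , s≤s (proj₁ (∈-chains⁻ (false ∷ []) m v∈)) , ℕ.≤-refl
  identity≢ : ∀ y → Proper y → swap zero zero ≢ swap′ y
  identity≢ (c ∷ e ∷ []) ex eq with () ← proj₁ (swap-exchanged c e zero zero (sym eq) ex)
  cuts-unique : List.Unique cuts
  cuts-unique = All.tabulate (λ {y} y∈ eq → identity≢ y (∈-proper⁻ y∈) (cong swap′ eq)) ∷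
                Unique.map⁺ map-suc-injective (chains-unique (false ∷ []) m)
  injective : ∀ y y′ → y ∈ cuts → y′ ∈ cuts → swap′ y ≡ swap′ y′ → y ≡ y′
  injective y y′ (here refl) (here refl) eq = refl
  injective y y′ (here refl) (there y′∈) eq = contradiction eq (identity≢ y′ (∈-proper⁻ y′∈))
  injective y y′ (there y∈)  (here refl) eq = contradiction (sym eq) (identity≢ y (∈-proper⁻ y∈))
  injective (c ∷ e ∷ []) (c′ ∷ e′ ∷ []) (there y∈) (there y′∈) eq
    with refl , refl ← swap-injective c e c′ e′ (∈-proper⁻ y∈) (∈-proper⁻ y′∈) eq = refl
  into : ∀ {y} → y ∈ cuts → swap′ y ∈ S[132,321] (suc m)
  into {c ∷ e ∷ []} _ = ∈-S[132,321]⁺ (swap-avoiding c e)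
  swap-identity : ∀ c e → (∀ i j → ¬ Exchanged c e i j) → swap c e ≡ swap zero zero
  swap-identity c e none = order⇒≡ (swap-unique c e) (swap-unique zero zero) λ {i} {j} i<j →
    mk⇔ (λ inv → contradiction (exchanged c e i<j inv) (none i j))
        (λ inv → contradiction (proj₁ (exchanged zero zero i<j inv)) λ ())
  -- Pairs with c = 0 or e < c exchange nothing and are sent to the representative (0, 0).
  covered : ∀ c e → ∃ λ y → y ∈ cuts × swap c e ≡ swap′ y
  covered zero    e    = _ , here refl , swap-identity zero e (λ _ _ → λ { (() , _) })
  covered (suc c) zero = _ , here refl ,
    swap-identity (suc c) zero (λ _ _ (_ , c≤j , j≤e) → contradiction (ℕ.≤-trans c≤j j≤e) λ ())
  covered (suc c) (suc e) with c Fin.≤? e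
  ... | yes c≤e = _ , there (∈.∈-map⁺ (Vec.map suc) (∈-chains⁺ (false ∷ []) m {c ∷ e ∷ []} (c≤e , tt))) , refl
  ... | no  c≰e = _ , here refl ,
    swap-identity (suc c) (suc e) (λ _ _ (_ , c≤j , j≤e) → c≰e (ℕ.s≤s⁻¹ (ℕ.≤-trans c≤j j≤e)))
  onto : ∀ {σ} → σ ∈ S[132,321] (suc m) → ∃ λ y → y ∈ cuts × σ ≡ swap′ y
  onto σ∈ =
    let c , e , σ≡swap = ∈-S[132,321]⇒swap σ∈
        y , y∈ , swap≡ = covered c e
    in y , y∈ , trans σ≡swap swap≡

Cut : ℕ → Set
Cut n = (Fin n × Fin n) × Vec (Fin n) 3

swapᶜ : Cut n → Vec (Fin n) n × Vec (Fin n) 3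
swapᶜ ((c , e) , is) = swap c e , is

-- The occurrences of q in swap c e correspond to the chains interleaving c and
-- e with the three positions as prescribed by split and bs.
total-chains : ∀ {m} (q : Vec (Fin 3) 3) (bs : Vec Bool 4)
  (split : Vec (Fin (suc m)) 5 → Cut (suc m)) (join : Cut (suc m) → Vec (Fin (suc m)) 5) →
  (∀ y → join (split y) ≡ y) → (∀ z → split (join z) ≡ z) →
  (∀ z → Chain bs (join z) → ∃₂ λ i j → uncurry Exchanged (proj₁ z) i j) →
  (∀ z → Chain bs (join z) → uncurry (Occurrence q) (swapᶜ z)) →
  (∀ z → uncurry (Occurrence q) (swapᶜ z) → Chain bs (join z)) →
  total q (suc m) ≡ (suc m ℕ.+ weak bs) C 5
total-chains {m} q bs split join join-split split-join inverts sound complete = begin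
  total q N
    -- The sum over permutations becomes the number of pairs of a permutation and an occurrence in
    -- it.
    ≡⟨ length-filter-cartesianProduct occurrence?′ (S[132,321] N) (words N 3) ⟨
  length (filter occurrence?′ pairs)
    ≡⟨ length-bijection (swapᶜ ∘ split)
         (Unique.filter⁺ occurrence?′ (Unique.cartesianProduct⁺ (S[132,321]-unique N) (words-unique N 3)))
         (chains-unique bs N) injective into onto ⟩
  length (chains bs N)
    ≡⟨ length-chains bs N ⟩
  (N ℕ.+ weak bs) C 5 ∎
  where
  open ≡-Reasoning
  N : ℕ
  N = suc m
  pairs : List (Vec (Fin N) N × Vec (Fin N) 3)
  pairs = cartesianProduct (S[132,321] N) (words N 3)
  occurrence?′ : Decidable (uncurry (Occurrence q))
  occurrence?′ (σ , is) = occurrence? q σ is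
  chain : ∀ {y} → y ∈ chains bs N → Chain bs (join (split y))
  chain {y} y∈ = subst (Chain bs) (sym (join-split y)) (∈-chains⁻ bs N y∈)
  swapᶜ-injective : ∀ z z′ → Chain bs (join z) → Chain bs (join z′) → swapᶜ z ≡ swapᶜ z′ → z ≡ z′
  swapᶜ-injective z@((c , e) , _) z′@((c′ , e′) , _) ch ch′ eq
    -- Each chain contains an exchanged pair, so the cut can be recovered from the permutation.
    with _ , _ , ex ← inverts z ch | _ , _ , ex′ ← inverts z′ ch′
    with refl , refl ← swap-injective c e c′ e′ ex ex′ (cong proj₁ eq) = cong ((c , e) ,_) (cong proj₂ eq)
  injective : ∀ {y y′} → y ∈ chains bs N → y′ ∈ chains bs N → swapᶜ (split y) ≡ swapᶜ (split y′) → y ≡ y′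
  injective {y} {y′} y∈ y′∈ eq = trans (sym (join-split y)) (trans
    (cong join (swapᶜ-injective (split y) (split y′) (chain y∈) (chain y′∈) eq)) (join-split y′))
  into : ∀ {y} → y ∈ chains bs N → swapᶜ (split y) ∈ filter occurrence?′ pairs
  into {y} y∈ = ∈.∈-filter⁺ occurrence?′
    (∈.∈-cartesianProduct⁺ (∈-S[132,321]⁺ (swap-avoiding _ _)) (∈-words (proj₂ (split y))))
    (sound (split y) (chain y∈))
  onto : ∀ {x} → x ∈ filter occurrence?′ pairs → ∃ λ y → y ∈ chains bs N × x ≡ swapᶜ (split y)
  onto {σ , is} x∈ = found (∈-S[132,321]⇒swap (proj₁ (∈.∈-cartesianProduct⁻ (S[132,321] N) (words N 3) (proj₁ x∈′))))
    where
    x∈′ : (σ , is) ∈ pairs × Occurrence q σ is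
    x∈′ = ∈.∈-filter⁻ occurrence?′ {xs = pairs} x∈
    found : (∃₂ λ c e → σ ≡ swap c e) → ∃ λ y → y ∈ chains bs N × (σ , is) ≡ swapᶜ (split y)
    found (c , e , σ≡swap) =
      join ((c , e) , is) ,
      ∈-chains⁺ bs N (complete _ (subst (λ σ → Occurrence q σ is) σ≡swap (proj₂ x∈′))) ,
      trans (cong (_, is) σ≡swap) (cong swapᶜ (sym (split-join ((c , e) , is))))

total-231 : ∀ m → total p231 (suc m) ≡ (suc m ℕ.+ 2) C 5
total-231 m = total-chains {m} p231 (true ∷ true ∷ false ∷ false ∷ [])
  (λ { (i ∷ j ∷ c ∷ l ∷ e ∷ []) → (c , e) , i ∷ j ∷ l ∷ [] })
  (λ { ((c , e) , i ∷ j ∷ l ∷ []) → i ∷ j ∷ c ∷ l ∷ e ∷ [] })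
  (λ { (i ∷ j ∷ c ∷ l ∷ e ∷ []) → refl })
  (λ { ((c , e) , i ∷ j ∷ l ∷ []) → refl })
  (λ { ((c , e) , i ∷ j ∷ l ∷ []) (i<j , j<c , c≤l , l≤e , _) → j , l , j<c , c≤l , l≤e })
  (λ { ((c , e) , i ∷ j ∷ l ∷ []) (i<j , j<c , c≤l , l≤e , _) →
       occurrence-231 (swap c e) i<j (ℕ.<-≤-trans j<c c≤l)
         (Equivalence.from (inversion-swap c e (ℕ.<-trans i<j (ℕ.<-≤-trans j<c c≤l))) (ℕ.<-trans i<j j<c , c≤l , l≤e))
         (swap-ascent c e i<j λ (_ , c≤j , _) → ℕ.<⇒≱ j<c c≤j) })
  -- Both (i, l) and (j, l) are inversions, which places j before `c` and l in the second block.
  (λ { ((c , e) , i ∷ j ∷ l ∷ []) o →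
       let i<j , j<l = increasing⁻ (proj₁ o)
           i<c , c≤l , l≤e = exchanged c e (ℕ.<-trans i<j j<l) (occurrence-order p231 (swap c e) o 2F 0F (s≤s z≤n))
           j<c , _ = exchanged c e j<l (occurrence-order p231 (swap c e) o 2F 1F (s≤s z≤n))
       in i<j , j<c , c≤l , l≤e , tt })

total-213 : ∀ m → total p213 (suc m) ≡ (suc m ℕ.+ 2) C 5
total-213 m = total-chains {m} p213 (true ∷ false ∷ false ∷ true ∷ [])
  (λ { (i ∷ c ∷ j ∷ e ∷ l ∷ []) → (c , e) , i ∷ j ∷ l ∷ [] })
  (λ { ((c , e) , i ∷ j ∷ l ∷ []) → i ∷ c ∷ j ∷ e ∷ l ∷ [] })
  (λ { (i ∷ c ∷ j ∷ e ∷ l ∷ []) → refl })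
  (λ { ((c , e) , i ∷ j ∷ l ∷ []) → refl })
  (λ { ((c , e) , i ∷ j ∷ l ∷ []) (i<c , c≤j , j≤e , e<l , _) → i , j , i<c , c≤j , j≤e })
  (λ { ((c , e) , i ∷ j ∷ l ∷ []) (i<c , c≤j , j≤e , e<l , _) →
       let i<j = ℕ.<-≤-trans i<c c≤j
           j<l = ℕ.≤-<-trans j≤e e<l
       in occurrence-213 (swap c e) i<j j<l
            (Equivalence.from (inversion-swap c e i<j) (i<c , c≤j , j≤e))
            (swap-ascent c e (ℕ.<-trans i<j j<l) λ (_ , _ , l≤e) → ℕ.<⇒≱ e<l l≤e) })
  (λ { ((c , e) , i ∷ j ∷ l ∷ []) o →
       let i<j , j<l = increasing⁻ (proj₁ o)
           i<c , c≤j , j≤e = exchanged c e i<j (occurrence-order p213 (swap c e) o 1F 0F (s≤s z≤n))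
           ¬ex = not-exchanged c e (ℕ.<-trans i<j j<l) (occurrence-order p213 (swap c e) o 0F 2F (s≤s (s≤s z≤n)))
       -- As i < c ≤ l already holds, (i, l) can fail to be an inversion only through e < l.
       in i<c , c≤j , j≤e , ℕ.≰⇒> (λ l≤e → ¬ex (i<c , ℕ.≤-trans c≤j (ℕ.<⇒≤ j<l) , l≤e)) , tt })

total-312 : ∀ m → total p312 (suc m) ≡ (suc m ℕ.+ 2) C 5
total-312 m = total-chains {m} p312 (true ∷ false ∷ true ∷ false ∷ [])
  (λ { (i ∷ c ∷ j ∷ l ∷ e ∷ []) → (c , e) , i ∷ j ∷ l ∷ [] })
  (λ { ((c , e) , i ∷ j ∷ l ∷ []) → i ∷ c ∷ j ∷ l ∷ e ∷ [] })
  (λ { (i ∷ c ∷ j ∷ l ∷ e ∷ []) → refl })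
  (λ { ((c , e) , i ∷ j ∷ l ∷ []) → refl })
  (λ { ((c , e) , i ∷ j ∷ l ∷ []) (i<c , c≤j , j<l , l≤e , _) →
       i , l , i<c , ℕ.≤-trans c≤j (ℕ.<⇒≤ j<l) , l≤e })
  (λ { ((c , e) , i ∷ j ∷ l ∷ []) (i<c , c≤j , j<l , l≤e , _) →
       let i<j = ℕ.<-≤-trans i<c c≤j
       in occurrence-312 (swap c e) i<j j<l
            (swap-ascent c e j<l λ (j<c , _) → ℕ.<⇒≱ j<c c≤j)
            (Equivalence.from (inversion-swap c e (ℕ.<-trans i<j j<l))
              (i<c , ℕ.≤-trans c≤j (ℕ.<⇒≤ j<l) , l≤e)) })
  -- Here (i, j) and (i, l) are inversions, so j and l both lie in the second block.
  (λ { ((c , e) , i ∷ j ∷ l ∷ []) o →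
       let i<j , j<l = increasing⁻ (proj₁ o)
           i<c , c≤j , _ = exchanged c e i<j (occurrence-order p312 (swap c e) o 1F 0F (s≤s z≤n))
           _ , _ , l≤e = exchanged c e (ℕ.<-trans i<j j<l) (occurrence-order p312 (swap c e) o 2F 0F (s≤s (s≤s z≤n)))
       in i<c , c≤j , j<l , l≤e , tt })

-- Comparing the three letters leaves six possible patterns, two of which are avoided.
classify : {σ : Vec (Fin n) n} → Avoiding σ → {is : Vec (Fin n) 3} → AllPairs Fin._<_ is →
           Occurrence p123 σ is ⊎ Occurrence p213 σ is ⊎ Occurrence p231 σ is ⊎ Occurrence p312 σ is
classify {σ = σ} av {i ∷ j ∷ l ∷ []} ((i<j VecAll.∷ i<l VecAll.∷ _) ∷ (j<l VecAll.∷ _) ∷ _)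
  with lookup σ i Fin.<? lookup σ j | lookup σ j Fin.<? lookup σ l | lookup σ i Fin.<? lookup σ l
... | yes i↗j | yes j↗l | _       = inj₁ (occurrence-123 σ i<j j<l i↗j j↗l)
... | yes i↗j | no  j↘l | yes i↗l = contradiction (occurrence-132 σ i<j j<l i↗l (≮⇒> j<l j↘l)) (no132 _)
  where open Avoiding av; open Permutation unique
... | yes i↗j | no  j↘l | no  i↘l = inj₂ (inj₂ (inj₁ (occurrence-231 σ i<j j<l (≮⇒> i<l i↘l) i↗j)))
  where open Avoiding av; open Permutation unique
... | no  i↘j | yes j↗l | yes i↗l = inj₂ (inj₁ (occurrence-213 σ i<j j<l (≮⇒> i<j i↘j) i↗l))
  where open Avoiding av; open Permutation unique
... | no  i↘j | yes j↗l | no  i↘l = inj₂ (inj₂ (inj₂ (occurrence-312 σ i<j j<l j↗l (≮⇒> i<l i↘l))))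
  where open Avoiding av; open Permutation unique
... | no  i↘j | no  j↘l | _       =
  contradiction (occurrence-321 σ i<j j<l (≮⇒> j<l j↘l) (≮⇒> i<j i↘j)) (no321 _)
  where open Avoiding av; open Permutation unique

length-increasing : ∀ n → length (filter (VecPairs.allPairs? Fin._<?_) (words n 3)) ≡ n C 3
length-increasing n = begin
  length (filter increasing? (words n 3))
    ≡⟨ length-set (Unique.filter⁺ increasing? (words-unique n 3)) (chains-unique bs n) to from ⟩
  length (chains bs n)
    ≡⟨ length-chains bs n ⟩
  (n ℕ.+ 0) C 3
    ≡⟨ cong (_C 3) (ℕ.+-identityʳ n) ⟩
  n C 3 ∎
  where
  open ≡-Reasoning
  bs : Vec Bool 2
  bs = true ∷ true ∷ []
  increasing? : Decidable {A = Vec (Fin n) 3} (AllPairs Fin._<_)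
  increasing? = VecPairs.allPairs? Fin._<?_
  to : ∀ {is} → is ∈ filter increasing? (words n 3) → is ∈ chains bs n
  to {i ∷ j ∷ l ∷ []} is∈ with ∈.∈-filter⁻ increasing? {xs = words n 3} is∈
  ... | _ , (i<j VecAll.∷ _) ∷ (j<l VecAll.∷ _) ∷ _ = ∈-chains⁺ bs n (i<j , j<l , tt)
  from : ∀ {is} → is ∈ chains bs n → is ∈ filter increasing? (words n 3)
  from {i ∷ j ∷ l ∷ []} is∈ with i<j , j<l , _ ← ∈-chains⁻ bs n is∈ =
    ∈.∈-filter⁺ increasing? (∈-words _) (increasing i<j j<l)

-- By `classify` the four patterns cover all increasing triples. Any two of them order some pair of
-- positions differently, so no triple is counted twice.
occurrences-sum : {σ : Vec (Fin n) n} → Avoiding σ →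
  occurrences p123 σ ℕ.+ (occurrences p213 σ ℕ.+ (occurrences p231 σ ℕ.+ occurrences p312 σ)) ≡ n C 3
occurrences-sum {n} {σ} av = begin
  occurrences p123 σ ℕ.+ (occurrences p213 σ ℕ.+ (occurrences p231 σ ℕ.+ occurrences p312 σ))
    ≡⟨ cong (λ k → occurrences p123 σ ℕ.+ (occurrences p213 σ ℕ.+ k))
         (length-filter-⊎ 231-312? (occ? p231) (occ? p312) id id
           (occurrences-disjoint p231 p312 0F 1F (s≤s (s≤s z≤n)) (λ ()) σ) (words n 3)) ⟨
  occurrences p123 σ ℕ.+ (occurrences p213 σ ℕ.+ count 231-312?)
    ≡⟨ cong (occurrences p123 σ ℕ.+_)
         (length-filter-⊎ 213-231-312? (occ? p213) 231-312? id id
           (λ o → λ { (inj₁ o′) → occurrences-disjoint p213 p231 0F 2F (s≤s (s≤s z≤n)) (λ ()) σ o o′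
                    ; (inj₂ o′) → occurrences-disjoint p213 p312 0F 2F (s≤s (s≤s z≤n)) (λ { (s≤s ()) }) σ o o′ }) (words n 3)) ⟨
  occurrences p123 σ ℕ.+ count 213-231-312?
    ≡⟨ length-filter-⊎ increasing? (occ? p123) 213-231-312? (classify av)
         (λ { (inj₁ o) → proj₁ o ; (inj₂ (inj₁ o)) → proj₁ o
            ; (inj₂ (inj₂ (inj₁ o))) → proj₁ o ; (inj₂ (inj₂ (inj₂ o))) → proj₁ o })
         (λ o → λ { (inj₁ o′)        → occurrences-disjoint p123 p213 0F 1F (s≤s z≤n) (λ ()) σ o o′
                  ; (inj₂ (inj₁ o′)) → occurrences-disjoint p123 p231 0F 2F (s≤s z≤n) (λ ()) σ o o′
                  ; (inj₂ (inj₂ o′)) → occurrences-disjoint p123 p312 0F 1F (s≤s z≤n) (λ ()) σ o o′ }) (words n 3) ⟨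
  count increasing?
    ≡⟨ length-increasing n ⟩
  n C 3 ∎
  where
  open ≡-Reasoning
  count : {P : Vec (Fin n) 3 → Set} → Decidable P → ℕ
  count P? = length (filter P? (words n 3))
  increasing? : Decidable {A = Vec (Fin n) 3} (AllPairs Fin._<_)
  increasing? = VecPairs.allPairs? Fin._<?_
  occ? : (q : Vec (Fin 3) 3) → Decidable (Occurrence q σ)
  occ? q = occurrence? q σ
  231-312? : Decidable (λ is → Occurrence p231 σ is ⊎ Occurrence p312 σ is)
  231-312? is = occ? p231 is ⊎-dec occ? p312 is
  213-231-312? : Decidable (λ is → Occurrence p213 σ is ⊎ Occurrence p231 σ is ⊎ Occurrence p312 σ is)
  213-231-312? is = occ? p213 is ⊎-dec 231-312? is

total-sum : ∀ m → let n = suc m in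
  total p123 n ℕ.+ (total p213 n ℕ.+ (total p231 n ℕ.+ total p312 n)) ≡ suc (n C 2) ℕ.* (n C 3)
total-sum m = begin
  total p123 N ℕ.+ (total p213 N ℕ.+ (total p231 N ℕ.+ total p312 N))
    ≡⟨ cong (λ k → total p123 N ℕ.+ (total p213 N ℕ.+ k)) (sum-map-+ f₂₃₁ f₃₁₂ perms) ⟨
  total p123 N ℕ.+ (total p213 N ℕ.+ sum (map (λ σ → f₂₃₁ σ ℕ.+ f₃₁₂ σ) perms))
    ≡⟨ cong (total p123 N ℕ.+_) (sum-map-+ f₂₁₃ (λ σ → f₂₃₁ σ ℕ.+ f₃₁₂ σ) perms) ⟨
  total p123 N ℕ.+ sum (map (λ σ → f₂₁₃ σ ℕ.+ (f₂₃₁ σ ℕ.+ f₃₁₂ σ)) perms)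
    ≡⟨ sum-map-+ f₁₂₃ (λ σ → f₂₁₃ σ ℕ.+ (f₂₃₁ σ ℕ.+ f₃₁₂ σ)) perms ⟨
  sum (map (λ σ → f₁₂₃ σ ℕ.+ (f₂₁₃ σ ℕ.+ (f₂₃₁ σ ℕ.+ f₃₁₂ σ))) perms)
    ≡⟨ sum-map-const _ (N C 3) perms (occurrences-sum ∘ ∈-S[132,321]⁻) ⟩
  length perms ℕ.* (N C 3)
    ≡⟨ cong (ℕ._* (N C 3)) (length-S[132,321] m) ⟩
  suc (N C 2) ℕ.* (N C 3) ∎
  where
  open ≡-Reasoning
  N : ℕ
  N = suc m
  perms = S[132,321] N
  f₁₂₃ f₂₁₃ f₂₃₁ f₃₁₂ : Vec (Fin N) N → ℕ
  f₁₂₃ = occurrences p123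
  f₂₁₃ = occurrences p213
  f₂₃₁ = occurrences p231
  f₃₁₂ = occurrences p312

-- Closed forms

-- The absorption identity, by induction through Pascal's rule.
suc-*-C : ∀ n k → suc k ℕ.* (suc n C suc k) ≡ suc n ℕ.* (n C k)
suc-*-C n       zero    = begin
  1 ℕ.* (suc n C 1)  ≡⟨ ℕ.*-identityˡ _ ⟩
  suc n C 1          ≡⟨ nC1≡n (suc n) ⟩
  suc n              ≡⟨ ℕ.*-identityʳ (suc n) ⟨
  suc n ℕ.* 1        ∎
  where open ≡-Reasoning
suc-*-C zero    (suc k) = begin
  suc (suc k) ℕ.* (1 C suc (suc k))  ≡⟨ cong (suc (suc k) ℕ.*_) (k>n⇒nCk≡0 {1} {suc (suc k)} (s≤s (s≤s z≤n))) ⟩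
  suc (suc k) ℕ.* 0                  ≡⟨ ℕ.*-zeroʳ (suc (suc k)) ⟩
  0                                  ≡⟨ cong (1 ℕ.*_) (k>n⇒nCk≡0 {0} {suc k} (s≤s z≤n)) ⟨
  1 ℕ.* (0 C suc k)                  ∎
  where open ≡-Reasoning
suc-*-C (suc n) (suc k) = begin
  (2 ℕ.+ k) ℕ.* (suc (suc n) C suc (suc k))
    ≡⟨ cong ((2 ℕ.+ k) ℕ.*_) (nCk+nC[k+1]≡[n+1]C[k+1] (suc n) (suc k)) ⟨
  (2 ℕ.+ k) ℕ.* (x ℕ.+ (suc n C suc (suc k)))
    ≡⟨ ℕ.*-distribˡ-+ (2 ℕ.+ k) x _ ⟩
  x ℕ.+ suc k ℕ.* x ℕ.+ (2 ℕ.+ k) ℕ.* (suc n C suc (suc k))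
    ≡⟨ cong₂ (λ y z → x ℕ.+ y ℕ.+ z) (suc-*-C n k) (suc-*-C n (suc k)) ⟩
  x ℕ.+ suc n ℕ.* (n C k) ℕ.+ suc n ℕ.* (n C suc k)
    ≡⟨ ℕ.+-assoc x _ _ ⟩
  x ℕ.+ (suc n ℕ.* (n C k) ℕ.+ suc n ℕ.* (n C suc k))
    ≡⟨ cong (x ℕ.+_) (ℕ.*-distribˡ-+ (suc n) (n C k) _) ⟨
  x ℕ.+ suc n ℕ.* (n C k ℕ.+ n C suc k)
    ≡⟨ cong (λ y → x ℕ.+ suc n ℕ.* y) (nCk+nC[k+1]≡[n+1]C[k+1] n k) ⟩
  suc (suc n) ℕ.* x ∎
  where
  open ≡-Reasoning
  x : ℕ
  x = suc n C suc k

factor-C : ∀ n k f {p} → f ℕ.* (n C k) ≡ p → (f ℕ.* suc k) ℕ.* (suc n C suc k) ≡ suc n ℕ.* p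
factor-C n k f {p} eq = begin
  f ℕ.* suc k ℕ.* (suc n C suc k)      ≡⟨ ℕ.*-assoc f (suc k) _ ⟩
  f ℕ.* (suc k ℕ.* (suc n C suc k))    ≡⟨ cong (f ℕ.*_) (suc-*-C n k) ⟩
  f ℕ.* (suc n ℕ.* (n C k))            ≡⟨ x∙yz≈y∙xz f (suc n) _ ⟩
  suc n ℕ.* (f ℕ.* (n C k))            ≡⟨ cong (suc n ℕ.*_) eq ⟩
  suc n ℕ.* p                          ∎
  where
  open ≡-Reasoning
  open import Algebra.Properties.CommutativeSemigroup ℕ.*-commutativeSemigroup using (x∙yz≈y∙xz)

-- The product (m+1)(m+2)⋯(m+k), which expresses binomial coefficients without division.
rising : ℕ → ℕ → ℕ
rising zero    m = 1
rising (suc k) m = (suc k ℕ.+ m) ℕ.* rising k m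

k!*C : ∀ k m → k ! ℕ.* ((k ℕ.+ m) C k) ≡ rising k m
k!*C zero    m = refl
k!*C (suc k) m = trans
  (cong (ℕ._* (suc (k ℕ.+ m) C suc k)) (ℕ.*-comm (suc k) (k !)))
  (factor-C (k ℕ.+ m) k (k !) (k!*C k m))

-- n (7n⁴ − 40n³ + 85n² − 80n + 28) expanded in m = n − 3, where all
-- coefficients are nonnegative.
total-123 : ∀ m → total p123 (3 ℕ.+ m) ℕ.* 120 ≡
  120 ℕ.+ m ℕ.* (358 ℕ.+ m ℕ.* (415 ℕ.+ m ℕ.* (235 ℕ.+ m ℕ.* (65 ℕ.+ m ℕ.* 7))))
-- To avoid subtraction, 120 times the other three totals is added to both sides; each of them
-- contributes `rising 5 m`.
total-123 m = ℕ.+-cancelʳ-≡ (3 ℕ.* rising 5 m) _ _ (begin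
  t ℕ.* 120 ℕ.+ 3 ℕ.* rising 5 m
    ≡⟨ cong (λ k → t ℕ.* 120 ℕ.+ 3 ℕ.* k) (k!*C 5 m) ⟨
  t ℕ.* 120 ℕ.+ 3 ℕ.* (120 ℕ.* b)
    ≡⟨ scale t b ⟩
  120 ℕ.* (t ℕ.+ (b ℕ.+ (b ℕ.+ b)))
    ≡⟨ cong (120 ℕ.*_) sum≡ ⟩
  120 ℕ.* (suc c₂ ℕ.* c₃)
    -- The factorisation 120 = 10 · 2 · 6 supplies the factorials 2! and 3! that `k!*C` needs.
    ≡⟨ split c₂ c₃ ⟩
  10 ℕ.* ((2 ℕ.+ 2 ℕ.* c₂) ℕ.* (6 ℕ.* c₃))
    ≡⟨ cong₂ (λ x y → 10 ℕ.* ((2 ℕ.+ x) ℕ.* y)) (k!*C 2 (suc m)) (k!*C 3 m) ⟩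
  10 ℕ.* ((2 ℕ.+ rising 2 (suc m)) ℕ.* rising 3 m)
    ≡⟨ expand m ⟩
  120 ℕ.+ m ℕ.* (358 ℕ.+ m ℕ.* (415 ℕ.+ m ℕ.* (235 ℕ.+ m ℕ.* (65 ℕ.+ m ℕ.* 7)))) ℕ.+ 3 ℕ.* rising 5 m ∎)
  where
  open ≡-Reasoning
  t b c₂ c₃ : ℕ
  t  = total p123 (3 ℕ.+ m)
  b  = (5 ℕ.+ m) C 5
  c₂ = (3 ℕ.+ m) C 2
  c₃ = (3 ℕ.+ m) C 3
  b≡ : (3 ℕ.+ m ℕ.+ 2) C 5 ≡ b
  b≡ = cong (λ k → (3 ℕ.+ k) C 5) (ℕ.+-comm m 2)
  sum≡ : t ℕ.+ (b ℕ.+ (b ℕ.+ b)) ≡ suc c₂ ℕ.* c₃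
  sum≡ = trans
    (cong (t ℕ.+_) (sym (cong₂ ℕ._+_ (trans (total-213 (2 ℕ.+ m)) b≡)
      (cong₂ ℕ._+_ (trans (total-231 (2 ℕ.+ m)) b≡) (trans (total-312 (2 ℕ.+ m)) b≡)))))
    (total-sum (2 ℕ.+ m))
  scale : ∀ t b → t ℕ.* 120 ℕ.+ 3 ℕ.* (120 ℕ.* b) ≡ 120 ℕ.* (t ℕ.+ (b ℕ.+ (b ℕ.+ b)))
  scale = NatSolver.solve-∀
  split : ∀ x y → 120 ℕ.* (suc x ℕ.* y) ≡ 10 ℕ.* ((2 ℕ.+ 2 ℕ.* x) ℕ.* (6 ℕ.* y))
  split = NatSolver.solve-∀
  expand : ∀ m → 10 ℕ.* ((2 ℕ.+ (3 ℕ.+ m) ℕ.* ((2 ℕ.+ m) ℕ.* 1)) ℕ.* ((3 ℕ.+ m) ℕ.* ((2 ℕ.+ m) ℕ.* ((1 ℕ.+ m) ℕ.* 1)))) ≡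
    120 ℕ.+ m ℕ.* (358 ℕ.+ m ℕ.* (415 ℕ.+ m ℕ.* (235 ℕ.+ m ℕ.* (65 ℕ.+ m ℕ.* 7)))) ℕ.+
    3 ℕ.* ((5 ℕ.+ m) ℕ.* ((4 ℕ.+ m) ℕ.* ((3 ℕ.+ m) ℕ.* ((2 ℕ.+ m) ℕ.* ((1 ℕ.+ m) ℕ.* 1)))))
  expand = NatSolver.solve-∀

-- In Horner form the embedding into the integers moves inward one coefficient at a time.
pos-horner : ∀ a m {x y} → + x ≡ y → + (a ℕ.+ m ℕ.* x) ≡ + a + + m * y
pos-horner a m {x} x≡y = cong (λ z → + a + z) (trans (ℤ.pos-* m x) (cong (λ z → + m * z) x≡y))

theorem2p18 : (n : ℕ) → n ≥ 3 →
    (total p213 n ≡ (n ℕ.+ 2) C 5) ×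
    (total p231 n ≡ (n ℕ.+ 2) C 5) ×
    (total p312 n ≡ (n ℕ.+ 2) C 5) ×
    (let N = + n in
    (+ total p123 n) / 1 ≡ (N * (+ 7 * N ^ 4 - + 40 * N ^ 3 + + 85 * N ^ 2 - + 80 * N + + 28)) / 120)
theorem2p18 (suc (suc (suc m))) (s≤s (s≤s (s≤s z≤n))) =
  total-213 (2 ℕ.+ m) , total-231 (2 ℕ.+ m) , total-312 (2 ℕ.+ m) ,
  -- Fractions are compared by cross multiplication before normalisation; `mkℚᵘ` takes the
  -- denominator minus one, so 0 and 119 stand for 1 and 120.
  fromℚᵘ-cong {mkℚᵘ (+ t) 0} {mkℚᵘ (polynomial (+ (3 ℕ.+ m))) 119} (*≡* (begin
    + t * + 120
      ≡⟨ ℤ.pos-* t 120 ⟨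
    + (t ℕ.* 120)
      ≡⟨ cong +_ (total-123 m) ⟩
    + (120 ℕ.+ m ℕ.* (358 ℕ.+ m ℕ.* (415 ℕ.+ m ℕ.* (235 ℕ.+ m ℕ.* (65 ℕ.+ m ℕ.* 7)))))
      ≡⟨ pos-horner 120 m (pos-horner 358 m (pos-horner 415 m (pos-horner 235 m (pos-horner 65 m refl)))) ⟩
    + 120 + + m * (+ 358 + + m * (+ 415 + + m * (+ 235 + + m * (+ 65 + + m * + 7))))
      ≡⟨ shift (+ m) ⟩
    polynomial (+ (3 ℕ.+ m)) * + 1 ∎))
  where
  open ≡-Reasoning
  t : ℕ
  t = total p123 (3 ℕ.+ m)
  polynomial : ℤ → ℤ
  polynomial N = N * (+ 7 * N ^ 4 - + 40 * N ^ 3 + + 85 * N ^ 2 - + 80 * N + + 28)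
  -- The substitution N = 3 + M, with the powers of N multiplied out for the ring solver.
  shift : ∀ M → + 120 + M * (+ 358 + M * (+ 415 + M * (+ 235 + M * (+ 65 + M * + 7)))) ≡
    ((+ 3 + M) * (+ 7 * ((+ 3 + M) * ((+ 3 + M) * ((+ 3 + M) * ((+ 3 + M) * + 1)))) -
      + 40 * ((+ 3 + M) * ((+ 3 + M) * ((+ 3 + M) * + 1))) +
      + 85 * ((+ 3 + M) * ((+ 3 + M) * + 1)) - + 80 * (+ 3 + M) + + 28)) * + 1
  shift = IntSolver.solve-∀
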